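{- A sequent is derivable in the (cut-free) calculus $\mathbf{L}^{\!+}_{\omega}(\vee)$ if and only if it is derivable in the (cut-free) calculus $\mathbf{L}^{\!+}_{\infty}(\vee)$.
   Context: Types are built from a countable set of variables (primitive types) using binary connectives $\cdot$, $\backslash$, $/$, $\vee$ and a unary connective ${}^+$ (written $A^+$). Capital Latin letters denote types; capital Greek letters denote finite (possibly empty) sequences of types. A sequent is $\Pi\to A$ with $A$ a type and $\Pi$ a non-empty finite sequence of types; all sequents, including those in rules, must have a non-empty left-hand side. Both calculi contain: axioms $A\to A$; $(\to\backslash)$: from $A,\Pi\to B$ infer $\Pi\to A\backslash B$ ($\Pi$ non-empty); $(\backslash\to)$: from $\Pi\to A$ and $\Gamma,B,\Delta\to C$ infer $\Gamma,\Pi,A\backslash B,\Delta\to C$; $(\to/)$: from $\Pi,A\to B$ infer $\Pi\to B/A$ ($\Pi$ non-empty); $(/\to)$: from $\Pi\to A$ and $\Gamma,B,\Delta\to C$ infer $\Gamma,B/A,\Pi,\Delta\to C$; $(\to\cdot)$: from $\Gamma\to A$ and $\Delta\to B$ infer $\Gamma,\Delta\to A\cdot B$; $(\cdot\to)$: from $\Gamma,A,B,\Delta\to C$ infer $\Gamma,A\cdot B,\Delta\to C$; $(\vee\to)$: from $\Gamma,A_1,\Delta\to C$ and $\Gamma,A_2,\Delta\to C$ infer $\Gamma,A_1\vee A_2,\Delta\to C$; $(\to\vee)$: from $\Gamma\to A_i$ infer $\Gamma\to A_1\vee A_2$ ($i=1,2$). Neither calculus contains the cut rule. $\mathbf{L}^{\!+}_{\omega}(\vee)$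 additionally has: $(\to{}^+)_n$ for each $n\ge1$: from $\Pi_1\to A,\dots,\Pi_n\to A$ infer $\Pi_1,\dots,\Pi_n\to A^+$; and the $\omega$-rule $({}^+\to)_\omega$: from the infinitely many premises $\Gamma,A,\Delta\to C$; $\Gamma,A,A,\Delta\to C$; $\Gamma,A,A,A,\Delta\to C$; $\dots$ infer $\Gamma,A^+,\Delta\to C$. Derivations are well-founded (possibly infinitely branching) trees. $\mathbf{L}^{\!+}_{\infty}(\vee)$ additionally has: $(\to{}^+)_1$: from $\Pi\to A$ infer $\Pi\to A^+$; $(\to{}^+)_{\mathrm L}$: from $\Pi_1\to A$ and $\Pi_2\to A^+$ infer $\Pi_1,\Pi_2\to A^+$; $({}^+\to)_{\mathrm L}$: from $\Gamma,A,\Delta\to C$ and $\Gamma,A,A^+,\Delta\to C$ infer $\Gamma,A^+,\Delta\to C$. Derivations in $\mathbf{L}^{\!+}_{\infty}(\vee)$ are arbitrary, possibly infinitely deep, (finitely branching) trees of sequents in which every node is either an axiom (a leaf) or is obtained from its children by one of the rules; infinite paths are allowed. -}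

module Defs where

open import Data.List.Base using (List; []; _∷_; _++_; drop; head; replicate)
open import Data.List.NonEmpty.Base
  using (List⁺; _∷_; [_]; toList; concat; _∷⁺_; _⁺∷ʳ_; _⁺++⁺_; _++⁺_)
open import Data.List.Relation.Unary.All using (All)
open import Data.Maybe.Base using (Maybe; just; nothing)
open import Data.Nat.Base using (ℕ)
open import Data.Product.Base using (_×_; ∃-syntax)
open import Relation.Binary.PropositionalEquality.Core using (_≡_)

infixl 9 _⁺
infixl 8 _·_
infixr 7 _∖_
infixl 7 _/_
infixl 6 _∨_
infix  3 _⟶_

data Type : Set where
  var             : ℕ → Type
  _·_ _∖_ _/_ _∨_ : Type → Type → Type
  _⁺              : Type → Type

-- Antecedents are non-empty lists, so the non-emptiness restriction is
-- built into every sequent, premises included.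
record Sequent : Set where
  constructor _⟶_
  field
    antecedent : List⁺ Type
    succedent  : Type

-- Rule ps s: s follows in one step from the list of premises ps.
-- Γ and Δ may be empty, Π may not: Γ , B , Δ is written Γ ++⁺ (B ∷ Δ).
data CommonRule : List Sequent → Sequent → Set where
  ax  : ∀ {A} → CommonRule [] ([ A ] ⟶ A)
  →∖  : ∀ {Π A B} →
        CommonRule ((A ∷⁺ Π ⟶ B) ∷ []) (Π ⟶ A ∖ B)
  ∖→  : ∀ {Γ Π Δ A B C} →
        CommonRule ((Π ⟶ A) ∷ (Γ ++⁺ (B ∷ Δ) ⟶ C) ∷ [])
                   (Γ ++⁺ (Π ⁺++⁺ (A ∖ B ∷ Δ)) ⟶ C)
  →/  : ∀ {Π A B} →
        CommonRule ((Π ⁺∷ʳ A ⟶ B) ∷ []) (Π ⟶ B / A)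
  /→  : ∀ {Γ Π Δ A B C} →
        CommonRule ((Π ⟶ A) ∷ (Γ ++⁺ (B ∷ Δ) ⟶ C) ∷ [])
                   (Γ ++⁺ (B / A ∷ toList Π ++ Δ) ⟶ C)
  →·  : ∀ {Γ Δ A B} →
        CommonRule ((Γ ⟶ A) ∷ (Δ ⟶ B) ∷ []) (Γ ⁺++⁺ Δ ⟶ A · B)
  ·→  : ∀ {Γ Δ A B C} →
        CommonRule ((Γ ++⁺ (A ∷ B ∷ Δ) ⟶ C) ∷ [])
                   (Γ ++⁺ (A · B ∷ Δ) ⟶ C)
  ∨→  : ∀ {Γ Δ A₁ A₂ C} →
        CommonRule ((Γ ++⁺ (A₁ ∷ Δ) ⟶ C) ∷ (Γ ++⁺ (A₂ ∷ Δ) ⟶ C) ∷ [])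
                   (Γ ++⁺ (A₁ ∨ A₂ ∷ Δ) ⟶ C)
  →∨₁ : ∀ {Γ A₁ A₂} → CommonRule ((Γ ⟶ A₁) ∷ []) (Γ ⟶ A₁ ∨ A₂)
  →∨₂ : ∀ {Γ A₁ A₂} → CommonRule ((Γ ⟶ A₂) ∷ []) (Γ ⟶ A₁ ∨ A₂)

data Lω : Sequent → Set where
  common : ∀ {ps s} → CommonRule ps s → All Lω ps → Lω s
  →⁺ₙ    : ∀ {A} (Πs : List⁺ (List⁺ Type)) →
           All (λ Π → Lω (Π ⟶ A)) (toList Πs) →
           Lω (concat Πs ⟶ A ⁺)
  -- The n-th premise has suc n copies of A.
  ⁺→ω    : ∀ {Γ Δ A C} →
           (∀ n → Lω (Γ ++⁺ (A ∷ replicate n A ++ Δ) ⟶ C)) →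
           Lω (Γ ++⁺ (A ⁺ ∷ Δ) ⟶ C)

data Rule∞ : List Sequent → Sequent → Set where
  common : ∀ {ps s} → CommonRule ps s → Rule∞ ps s
  →⁺₁    : ∀ {Π A} → Rule∞ ((Π ⟶ A) ∷ []) (Π ⟶ A ⁺)
  →⁺L    : ∀ {Π₁ Π₂ A} →
           Rule∞ ((Π₁ ⟶ A) ∷ (Π₂ ⟶ A ⁺) ∷ []) (Π₁ ⁺++⁺ Π₂ ⟶ A ⁺)
  ⁺→L    : ∀ {Γ Δ A C} →
           Rule∞ ((Γ ++⁺ (A ∷ Δ) ⟶ C) ∷ (Γ ++⁺ (A ∷ A ⁺ ∷ Δ) ⟶ C) ∷ [])
                 (Γ ++⁺ (A ⁺ ∷ Δ) ⟶ C)

-- A possibly infinite tree of sequents, as a partial labelling of addresses.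
-- The root has address [], and the i-th child of node p has address i ∷ p
-- (so an address lists the branch taken last first).  No condition is imposed
-- on infinite paths.
record L∞ (s : Sequent) : Set where
  field
    label   : List ℕ → Maybe Sequent
    root    : label [] ≡ just s
    closed  : ∀ p i → label p ≡ nothing → label (i ∷ p) ≡ nothing
    -- head (drop i ps) is the i-th entry of ps, or nothing if there is none.
    correct : ∀ p t → label p ≡ just t →
              ∃[ ps ] Rule∞ ps t × (∀ i → label (i ∷ p) ≡ head (drop i ps))

-- A derivation of Γ → C in Lω is itself a (well-founded) coalgebra for the rules
-- of L∞: peeling off the first formula turns (⁺→)_ω into (⁺→)_L and (→⁺)_n into
-- (→⁺)_L, so it unfolds to an infinite tree.  For the converse, let Γ ⊴ Γ′ mean
-- that Γ′ is Γ with some occurrences of formulas A⁺ replaced by nonempty powers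
-- of A.  If Γ → C has an L∞-tree and Γ ⊴ Γ′, then Γ′ → C is derivable in Lω, by
-- induction on the multiset of formula sizes of Γ′ → C.  The last rule of the tree
-- applies to Γ′ → C as well ((→⁺)_L is admissible in Lω), unless it is an axiom
-- A⁺ → A⁺, for which A,…,A → A⁺ is immediate, or (⁺→)_L.  If the principal formula
-- A⁺ of the latter has been replaced by a power, pass to the first premise when one
-- copy of A remains and to the second otherwise; Γ′ does not change, but this can
-- happen only finitely often in a row.  If A⁺ has been kept, the same tree yields
-- all premises of (⁺→)_ω.
module Submission where

open import Defs
import Algebra.Solver.CommutativeMonoid as CommutativeMonoidSolver
open import Data.Empty using (⊥-elim)
open import Data.List.Base
  using (List; []; _∷_; _++_; drop; head; replicate)
open import Data.List.Membership.Propositional.Properties using (∈-++⁻; ∈-∃++)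
open import Data.List.NonEmpty.Base as List⁺
  using (List⁺; _∷_; [_]; toList; _∷⁺_; _⁺++⁺_; _++⁺_)
open import Data.List.NonEmpty.Properties using (∷→∷⁺; ++-++⁺)
open import Data.List.Properties using (++-assoc; ++-identityʳ)
open import Data.List.Relation.Binary.Permutation.Propositional
  using (_↭_; ↭-refl; ↭-sym; ↭-trans; prep)
open import Data.List.Relation.Binary.Permutation.Propositional.Properties
  using (∈-resp-↭; ¬x∷xs↭[]; drop-∷; drop-mid; shift; ++⁺ˡ; ∷↭∷ʳ; ++-comm;
         ++-commutativeMonoid)
open import Data.List.Relation.Binary.Pointwise using (Pointwise; []; _∷_)
open import Data.List.Relation.Unary.All using (All; []; _∷_)
open import Data.List.Relation.Unary.All.Properties using (replicate⁺)
open import Data.List.Relation.Unary.Any using (here; there)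
open import Data.Maybe.Base as Maybe using (Maybe; just; nothing; _>>=_)
open import Data.Nat.Base using (ℕ; zero; suc; _+_; _<_; s≤s)
open import Data.Nat.Induction using (<-wellFounded)
open import Data.Nat.Properties using (m≤m+n; m≤n+m; n<1+n; +-assoc; +-monoʳ-<)
open import Data.Product.Base using (Σ; _×_; _,_; proj₁; ∃-syntax)
open import Data.Sum.Base using (_⊎_; inj₁; inj₂)
open import Function.Base using (_on_)
open import Function.Bundles using (_⇔_; mk⇔)
open import Induction.WellFounded using (WellFounded; Acc; acc)
open import Level using (0ℓ)
import Relation.Binary.Construct.On as On
open import Relation.Binary.Core using (Rel)
open import Relation.Binary.PropositionalEquality
  using (_≡_; refl; sym; trans; cong; subst)

-- Well-foundedness of the multiset ordering

module MultisetOrder {A : Set} {_<_ : Rel A 0ℓ} (<-wf : WellFounded _<_) where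

  infix 4 _≺_

  -- Discarding ds in the same step saves taking the transitive closure.
  data _≺_ (ys xs : List A) : Set where
    replace : ∀ a ks ds zs → xs ↭ a ∷ ds ++ zs → ys ↭ ks ++ zs → All (_< a) ks → ys ≺ xs

  private
    Acc-↭ : ∀ {xs ys} → xs ↭ ys → Acc _≺_ xs → Acc _≺_ ys
    Acc-↭ σ (acc rs) = acc λ where
      (replace a ks ds zs ρ τ lt) → rs (replace a ks ds zs (↭-trans σ ρ) τ lt)

    Acc-suffix : ∀ xs {ys} → Acc _≺_ (xs ++ ys) → Acc _≺_ ys
    Acc-suffix []       a        = a
    Acc-suffix (x ∷ xs) (acc rs) = rs (replace x [] xs _ ↭-refl ↭-refl [])

    mutual
      Acc-∷ : ∀ {a} → Acc _<_ a → ∀ {xs} → Acc _≺_ xs → Acc _≺_ (a ∷ xs)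
      Acc-∷ acc-a acc-xs = acc λ where
        (replace b ks ds zs ρ τ lt) → Acc-↭ (↭-sym τ) (Acc-pred acc-a acc-xs b ks ds ρ lt)

      Acc-++ : ∀ {a} → Acc _<_ a → ∀ {ks zs} → All (_< a) ks → Acc _≺_ zs → Acc _≺_ (ks ++ zs)
      Acc-++ _        []         acc-zs = acc-zs
      Acc-++ (acc rs) (lt ∷ lts) acc-zs = Acc-∷ (rs lt) (Acc-++ (acc rs) lts acc-zs)

      -- Lexicographic induction on `a`, then on `xs`. If `b` is `a` itself, the elements of `ks`
      -- lie below `a` and are added one by one. Otherwise `a` is discarded with `ds` or survives in
      -- `zs`; apart from it, what remains is a predecessor of `xs`.
      Acc-pred : ∀ {a} → Acc _<_ a → ∀ {xs} → Acc _≺_ xs → ∀ b ks ds {zs} →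
                 a ∷ xs ↭ b ∷ ds ++ zs → All (_< b) ks → Acc _≺_ (ks ++ zs)
      Acc-pred acc-a acc-xs b ks ds ρ lt with ∈-resp-↭ ρ (here refl)
      ... | here refl = Acc-++ acc-a lt (Acc-suffix ds (Acc-↭ (drop-∷ ρ) acc-xs))
      Acc-pred acc-a (acc rs) b ks ds {zs} ρ lt | there a∈ with ∈-++⁻ ds a∈
      ... | inj₁ a∈ds with ds₁ , ds₂ , refl ← ∈-∃++ a∈ds =
        rs (replace b ks (ds₁ ++ ds₂) zs
              (subst (λ l → _ ↭ b ∷ l) (sym (++-assoc ds₁ ds₂ zs))
                (drop-mid [] (b ∷ ds₁) (subst (λ l → _ ↭ b ∷ l) (++-assoc ds₁ _ zs) ρ)))
              ↭-refl lt)
      ... | inj₂ a∈zs with zs₁ , zs₂ , refl ← ∈-∃++ a∈zs =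
        Acc-↭ (↭-sym (↭-trans (++⁺ˡ ks (shift _ zs₁ zs₂)) (shift _ ks (zs₁ ++ zs₂))))
          (Acc-∷ acc-a
            (rs (replace b ks ds (zs₁ ++ zs₂)
                  (subst (λ l → _ ↭ b ∷ l) (++-assoc ds zs₁ zs₂)
                    (drop-mid [] (b ∷ ds ++ zs₁)
                      (subst (λ l → _ ↭ b ∷ l) (sym (++-assoc ds zs₁ _)) ρ)))
                  ↭-refl lt)))

  ≺-wellFounded : WellFounded _≺_
  ≺-wellFounded []       = acc λ where
    (replace _ _ _ _ ρ _ _) → ⊥-elim (¬x∷xs↭[] (↭-sym ρ))
  ≺-wellFounded (x ∷ xs) = Acc-∷ (<-wf x) (≺-wellFounded xs)

-- The measure of a sequent and its decrease

size : Type → ℕ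
size (var _) = 0
size (A · B) = suc (size A + size B)
size (A ∖ B) = suc (size A + size B)
size (A / B) = suc (size A + size B)
size (A ∨ B) = suc (size A + size B)
size (A ⁺)   = suc (size A)

_⊏_ : Rel Type 0ℓ
_⊏_ = _<_ on size

open MultisetOrder (On.wellFounded size <-wellFounded)

open CommutativeMonoidSolver (++-commutativeMonoid {A = Type}) using (solve; _⊜_; _⊕_)

private
  variable
    A B C : Type
    i j k : ℕ
    Γ Γ′ Δ Δ′ Θ : List Type
    s s′ : Sequent
    ps ps′ : List Sequent

∣_∣ : Sequent → List Type
∣ Γ ⟶ C ∣ = C ∷ toList Γ

infix 2 _≺ₛ_

_≺ₛ_ : Rel Sequent 0ℓ
_≺ₛ_ = _≺_ on ∣_∣

toList-++⁺ : ∀ {X : Set} (xs : List X) (ys : List⁺ X) → toList (xs ++⁺ ys) ≡ xs ++ toList ys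
toList-++⁺ []       ys = refl
toList-++⁺ (x ∷ xs) ys = cong (x ∷_) (toList-++⁺ xs ys)

⊏ˡ : ∀ m n → m < suc (m + n)
⊏ˡ m n = s≤s (m≤m+n m n)

⊏ʳ : ∀ m n → n < suc (m + n)
⊏ʳ m n = s≤s (m≤n+m n m)

-- Serves the premises that keep `Γ` and `C`: the principal formula `A` gives way to the smaller
-- `Φ`, and `ds` absorbs the `Π` that a division rule sends to its other premise.
left-≺ₛ : ∀ Γ (Π : List⁺ Type) {Φ Θ C A Δ} → toList Π ≡ Φ ++ Δ →
          ∀ ds → toList Θ ↭ A ∷ ds ++ Δ → All (_⊏ A) Φ →
          Γ ++⁺ Π ⟶ C ≺ₛ Γ ++⁺ Θ ⟶ C
left-≺ₛ Γ Π {Φ} {Θ} {C} {A} {Δ} eq ds ρ lt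
  rewrite toList-++⁺ Γ Π | toList-++⁺ Γ Θ | eq =
  replace A Φ ds (C ∷ Γ ++ Δ)
    (↭-trans (prep C (++⁺ˡ Γ ρ))
      (solve 5 (λ c γ a d δ → c ⊕ (γ ⊕ (a ⊕ (d ⊕ δ))) ⊜ a ⊕ (d ⊕ (c ⊕ (γ ⊕ δ)))) ↭-refl
        (C ∷ []) Γ (A ∷ []) ds Δ))
    (solve 4 (λ c γ σ δ → c ⊕ (γ ⊕ (σ ⊕ δ)) ⊜ σ ⊕ (c ⊕ (γ ⊕ δ))) ↭-refl (C ∷ []) Γ Φ Δ)
    lt

argument-≺ₛ : ∀ Γ Π {Θ C A B Δ} → toList Θ ↭ A ∷ toList Π ++ Δ → B ⊏ A →
              Π ⟶ B ≺ₛ Γ ++⁺ Θ ⟶ C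
argument-≺ₛ Γ Π {Θ} {C} {A} {B} {Δ} ρ lt rewrite toList-++⁺ Γ Θ =
  replace A (B ∷ []) (C ∷ Γ ++ Δ) (toList Π)
    (↭-trans (prep C (++⁺ˡ Γ ρ))
      (solve 5 (λ c γ a π δ → c ⊕ (γ ⊕ (a ⊕ (π ⊕ δ))) ⊜ a ⊕ ((c ⊕ (γ ⊕ δ)) ⊕ π)) ↭-refl
        (C ∷ []) Γ (A ∷ []) (toList Π) Δ))
    ↭-refl (lt ∷ [])

-- In the absence of cut, a premise has only immediate subformulas in place of the principal
-- formula; the other formulas are kept or dropped.
common-≺ₛ : CommonRule ps s → All (_≺ₛ s) ps
common-≺ₛ ax = []
common-≺ₛ (→∖ {Π} {A} {B}) =
  replace (A ∖ B) (B ∷ A ∷ []) [] (toList Π) ↭-refl ↭-refl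
    (⊏ʳ (size A) _ ∷ ⊏ˡ _ _ ∷ []) ∷ []
common-≺ₛ (∖→ {Γ} {Π} {Δ} {A} {B}) =
  argument-≺ₛ Γ Π σ (⊏ˡ _ _) ∷
  left-≺ₛ Γ (B ∷ Δ) refl (toList Π) σ (⊏ʳ (size A) _ ∷ []) ∷ []
  where
  σ : toList Π ++ A ∖ B ∷ Δ ↭ A ∖ B ∷ toList Π ++ Δ
  σ = shift _ (toList Π) Δ
common-≺ₛ (→/ {Π} {A} {B}) =
  replace (B / A) (B ∷ A ∷ []) [] (toList Π) ↭-refl
    (prep B (↭-sym (∷↭∷ʳ A (toList Π))))
    (⊏ˡ _ _ ∷ ⊏ʳ (size B) _ ∷ []) ∷ []
common-≺ₛ (/→ {Γ} {Π} {Δ} {A} {B}) =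
  argument-≺ₛ Γ Π ↭-refl (⊏ʳ (size B) _) ∷
  left-≺ₛ Γ (B ∷ Δ) refl (toList Π) ↭-refl (⊏ˡ _ _ ∷ []) ∷ []
common-≺ₛ (→· {Γ} {Δ} {A} {B}) =
  replace (A · B) (A ∷ []) (toList Δ) (toList Γ)
    (prep _ (++-comm (toList Γ) (toList Δ)))
    ↭-refl (⊏ˡ _ _ ∷ []) ∷
  replace (A · B) (B ∷ []) (toList Γ) (toList Δ)
    ↭-refl ↭-refl (⊏ʳ (size A) _ ∷ []) ∷ []
common-≺ₛ (·→ {Γ} {Δ} {A} {B}) =
  left-≺ₛ Γ (A ∷ B ∷ Δ) {A ∷ B ∷ []} refl [] ↭-refl (⊏ˡ _ _ ∷ ⊏ʳ (size A) _ ∷ []) ∷ []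
common-≺ₛ (∨→ {Γ} {Δ} {A} {B}) =
  left-≺ₛ Γ (A ∷ Δ) refl [] ↭-refl (⊏ˡ _ _ ∷ []) ∷
  left-≺ₛ Γ (B ∷ Δ) refl [] ↭-refl (⊏ʳ (size A) _ ∷ []) ∷ []
common-≺ₛ →∨₁ = replace _ (_ ∷ []) [] _ ↭-refl ↭-refl (⊏ˡ _ _ ∷ []) ∷ []
common-≺ₛ (→∨₂ {A₁ = A}) =
  replace _ (_ ∷ []) [] _ ↭-refl ↭-refl (⊏ʳ (size A) _ ∷ []) ∷ []

-- One `A ⁺` outweighs any number of copies of `A`, which is why multisets of sizes are compared and
-- not total sizes.
powers-≺ₛ : ∀ Γ n → Γ ++⁺ (A ∷ replicate n A ++ Δ) ⟶ C ≺ₛ Γ ++⁺ (A ⁺ ∷ Δ) ⟶ C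
powers-≺ₛ {A} Γ n = left-≺ₛ Γ _ refl [] ↭-refl (replicate⁺ (suc n) (n<1+n (size A)))

-- Post-fixed points of one-step derivability in `L∞`, and infinite trees

Coalgebra : (Sequent → Set) → Set
Coalgebra P = ∀ {s} → P s → ∃[ ps ] Rule∞ ps s × All P ps

module _ {P : Sequent → Set} (step : Coalgebra P) where

  private
    child : ∀ {ps} → ℕ → All P ps → Maybe (Σ Sequent P)
    child _       []       = nothing
    child zero    (x ∷ _)  = just (_ , x)
    child (suc i) (_ ∷ xs) = child i xs

    child-label : ∀ {ps} i (xs : All P ps) → Maybe.map proj₁ (child i xs) ≡ head (drop i ps)
    child-label zero    []       = refl
    child-label (suc _) []       = refl
    child-label zero    (x ∷ _)  = refl
    child-label (suc i) (_ ∷ xs) = child-label i xs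

    children : Σ Sequent P → ℕ → Maybe (Σ Sequent P)
    children (_ , x) i with step x
    ... | _ , _ , xs = child i xs

    -- Each node carries its witness of `P`, so that `step` can be applied again; the labels forget
    -- the witness.
    node : Σ Sequent P → List ℕ → Maybe (Σ Sequent P)
    node r []      = just r
    node r (i ∷ p) = node r p >>= λ x → children x i

  coalgebra⇒L∞ : P s → L∞ s
  coalgebra⇒L∞ {s} x = record
    { label   = label
    ; root    = refl
    ; closed  = closed
    ; correct = correct
    }
    where
    label : List ℕ → Maybe Sequent
    label p = Maybe.map proj₁ (node (s , x) p)

    closed : ∀ p i → label p ≡ nothing → label (i ∷ p) ≡ nothing
    closed p i eq with node (s , x) p
    closed p i () | just _
    ...           | nothing = refl

    correct : ∀ p t → label p ≡ just t →
              ∃[ ps ] Rule∞ ps t × (∀ i → label (i ∷ p) ≡ head (drop i ps))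
    correct p t eq with node (s , x) p
    correct p t refl | just (_ , y) with step y
    ... | ps , r , ys = ps , r , λ i → child-label i ys

Occurs : L∞ s → Sequent → Set
Occurs d t = ∃[ p ] L∞.label d p ≡ just t

occurs-coalgebra : (d : L∞ s) → Coalgebra (Occurs d)
occurs-coalgebra d (p , eq) with L∞.correct d p _ eq
... | ps , r , labels = ps , r , premises ps (_∷ p) labels
  where
  -- `f i` is the address of the `i`-th premise still to be treated, hence the shift in the
  -- recursive call.
  premises : ∀ ps (f : ℕ → List ℕ) → (∀ i → L∞.label d (f i) ≡ head (drop i ps)) →
             All (Occurs d) ps
  premises []       f h = []
  premises (_ ∷ ps) f h = (f 0 , h 0) ∷ premises ps (λ i → f (suc i)) (λ i → h (suc i))

-- `Lω` as a coalgebra, and admissibility of `→⁺L`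

cast : ∀ {Γ Δ} → Γ ≡ Δ → Lω (Γ ⟶ C) → Lω (Δ ⟶ C)
cast {C} = subst (λ Γ → Lω (Γ ⟶ C))

-- The first copy of `A` joins the left context, so the premises of the ω-rule with at least two
-- copies reassemble into the second premise of `⁺→L`.
⁺→ω-suc : ∀ Γ → (∀ n → Lω (Γ ++⁺ (A ∷ A ∷ replicate n A ++ Δ) ⟶ C)) →
          Lω (Γ ++⁺ (A ∷ A ⁺ ∷ Δ) ⟶ C)
⁺→ω-suc {A} Γ ds =
  cast (++-++⁺ Γ) (⁺→ω {Γ = Γ ++ A ∷ []} λ n → cast (sym (++-++⁺ Γ)) (ds n))

Lω-coalgebra : Coalgebra Lω
Lω-coalgebra (common r ds)                   = _ , common r , ds
Lω-coalgebra (→⁺ₙ (Π ∷ []) (d ∷ []))         =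
  _ , →⁺₁ , cast (∷→∷⁺ (sym (++-identityʳ (toList Π)))) d ∷ []
Lω-coalgebra (→⁺ₙ (Π ∷ Π′ ∷ Πs) (d ∷ ds))    = _ , →⁺L , d ∷ →⁺ₙ (Π′ ∷ Πs) ds ∷ []
Lω-coalgebra (⁺→ω {Γ} ds)                    =
  _ , ⁺→L {Γ} , ds 0 ∷ ⁺→ω-suc Γ (λ n → ds (suc n)) ∷ []

singletons : Type → ℕ → List⁺ (List⁺ Type)
singletons A n = [ A ] ∷ replicate n [ A ]

concat-singletons : ∀ A n → toList (List⁺.concat (singletons A n)) ≡ A ∷ replicate n A
concat-singletons A zero    = refl
concat-singletons A (suc n) = cong (A ∷_) (concat-singletons A n)

axioms : ∀ A n → All (λ Π → Lω (Π ⟶ A)) (toList (singletons A n))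
axioms A n = replicate⁺ (suc n) (common ax [])

⁺++⁺≡++⁺ : ∀ {X : Set} (xs ys : List⁺ X) → xs ⁺++⁺ ys ≡ toList xs ++⁺ ys
⁺++⁺≡++⁺ xs ys = ∷→∷⁺ (sym (toList-++⁺ (toList xs) ys))

-- Induction on the second derivation: left rules commute with prefixing `Π` to their left context,
-- and `→⁺ₙ` takes one more block. The axiom has no blocks to extend, so its `A ⁺` is first expanded
-- by the ω-rule.
→⁺L-admissible : ∀ {Π Δ} → Lω (Π ⟶ A) → Lω (Δ ⟶ A ⁺) → Lω (toList Π ++⁺ Δ ⟶ A ⁺)
→⁺L-admissible {A} {Π} d (common ax []) =
  ⁺→ω {Γ = toList Π} λ n →
    cast (trans (∷→∷⁺ (cong (toList Π ++_) (trans (concat-singletons A n)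
                 (sym (++-identityʳ (A ∷ replicate n A))))))
                (⁺++⁺≡++⁺ Π (A ∷ replicate n A ++ [])))
      (→⁺ₙ (Π ∷⁺ singletons A n) (d ∷ axioms A n))
→⁺L-admissible {Π = Π} d (common (∖→ {Γ}) (e ∷ f ∷ [])) =
  cast (++-++⁺ (toList Π)) (common (∖→ {Γ = toList Π ++ Γ})
    (e ∷ cast (sym (++-++⁺ (toList Π))) (→⁺L-admissible d f) ∷ []))
→⁺L-admissible {Π = Π} d (common (/→ {Γ}) (e ∷ f ∷ [])) =
  cast (++-++⁺ (toList Π)) (common (/→ {Γ = toList Π ++ Γ})
    (e ∷ cast (sym (++-++⁺ (toList Π))) (→⁺L-admissible d f) ∷ []))
→⁺L-admissible {Π = Π} d (common (·→ {Γ}) (f ∷ [])) =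
  cast (++-++⁺ (toList Π)) (common (·→ {Γ = toList Π ++ Γ})
    (cast (sym (++-++⁺ (toList Π))) (→⁺L-admissible d f) ∷ []))
→⁺L-admissible {Π = Π} d (common (∨→ {Γ}) (e ∷ f ∷ [])) =
  cast (++-++⁺ (toList Π)) (common (∨→ {Γ = toList Π ++ Γ})
    (cast (sym (++-++⁺ (toList Π))) (→⁺L-admissible d e) ∷
     cast (sym (++-++⁺ (toList Π))) (→⁺L-admissible d f) ∷ []))
→⁺L-admissible {Π = Π} d (→⁺ₙ Πs ds) =
  cast (⁺++⁺≡++⁺ Π (List⁺.concat Πs)) (→⁺ₙ (Π ∷⁺ Πs) (d ∷ ds))
→⁺L-admissible {Π = Π} d (⁺→ω {Γ} ds) =
  cast (++-++⁺ (toList Π)) (⁺→ω {Γ = toList Π ++ Γ} λ n →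
    cast (sym (++-++⁺ (toList Π))) (→⁺L-admissible d (ds n)))

-- Replacing formulas `A ⁺` by powers

infix 4 _⊴[_]_
infix 2 _⊑_

-- The index counts all copies of A written in place of formulas A ⁺.
data _⊴[_]_ : List Type → ℕ → List Type → Set where
  []     : [] ⊴[ 0 ] []
  _∷_    : ∀ A → Γ ⊴[ k ] Γ′ → A ∷ Γ ⊴[ k ] A ∷ Γ′
  expand : ∀ n → Γ ⊴[ k ] Γ′ → A ⁺ ∷ Γ ⊴[ suc n + k ] A ∷ replicate n A ++ Γ′

data _⊑_ : Sequent → Sequent → Set where
  ⟨_⟩ : ∀ {Γ Γ′} → toList Γ ⊴[ k ] toList Γ′ → Γ ⟶ C ⊑ Γ′ ⟶ C

⊴-refl : ∀ Γ → Γ ⊴[ 0 ] Γ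
⊴-refl []      = []
⊴-refl (A ∷ Γ) = A ∷ ⊴-refl Γ

⊴-++ : Γ ⊴[ i ] Γ′ → Δ ⊴[ j ] Δ′ → Γ ++ Δ ⊴[ i + j ] Γ′ ++ Δ′
⊴-++ []      f = f
⊴-++ (A ∷ e) f = A ∷ ⊴-++ e f
⊴-++ {j = j} {Δ′ = Δ′} (expand {k = k} {Γ′ = Γ′} {A = A} n e) f
  rewrite ++-assoc (replicate n A) Γ′ Δ′ | +-assoc n k j = expand n (⊴-++ e f)

⊴-++⁺ : ∀ {Δ Δ′} → Γ ⊴[ i ] Γ′ → toList Δ ⊴[ j ] toList Δ′ →
        toList (Γ ++⁺ Δ) ⊴[ i + j ] toList (Γ′ ++⁺ Δ′)
⊴-++⁺ {Γ} {Γ′ = Γ′} {Δ = Δ} {Δ′} e f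
  rewrite toList-++⁺ Γ Δ | toList-++⁺ Γ′ Δ′ = ⊴-++ e f

-- The count and the expanded list are indices, so matching on `split` turns them into a sum and a
-- concatenation at once.
data Split (Γ Δ : List Type) : ℕ → List Type → Set where
  split : Γ ⊴[ i ] Γ′ → Δ ⊴[ j ] Δ′ → Split Γ Δ (i + j) (Γ′ ++ Δ′)

⊴-split : ∀ Γ → Γ ++ Δ ⊴[ k ] Θ → Split Γ Δ k Θ
⊴-split []      e       = split [] e
⊴-split (A ∷ Γ) (A ∷ e) with split f g ← ⊴-split Γ e = split (A ∷ f) g
⊴-split (A ⁺ ∷ Γ) (expand n e) with ⊴-split Γ e
... | split {i} {Γ₁} {j} {Δ₁} f g
  rewrite sym (++-assoc (replicate n A) Γ₁ Δ₁) | sym (+-assoc n i j) = split (expand n f) g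

⊴-nonEmpty : ∀ {Γ} → toList Γ ⊴[ k ] Γ′ → ∃[ Γ⁺ ] Γ′ ≡ toList Γ⁺
⊴-nonEmpty (A ∷ _)      = _ , refl
⊴-nonEmpty (expand _ _) = _ , refl

data Split-++⁺ (Γ : List Type) (Δ : List⁺ Type) : ℕ → List⁺ Type → Set where
  split : ∀ {Δ′} → Γ ⊴[ i ] Γ′ → toList Δ ⊴[ j ] toList Δ′ → Split-++⁺ Γ Δ (i + j) (Γ′ ++⁺ Δ′)

⊴-split-++⁺ : ∀ Γ {Δ Θ} → toList (Γ ++⁺ Δ) ⊴[ k ] toList Θ → Split-++⁺ Γ Δ k Θ
⊴-split-++⁺ Γ {Δ} {Θ} e rewrite toList-++⁺ Γ Δ = from (⊴-split Γ e) refl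
  where
  -- The list is generalised to `Θ′` because the index `toList Θ` would not unify with a
  -- concatenation.
  from : ∀ {k Θ′} → Split Γ (toList Δ) k Θ′ → Θ′ ≡ toList Θ → Split-++⁺ Γ Δ k Θ
  from (split {Γ′ = Γ₁} f g) eq with Δ₁ , refl ← ⊴-nonEmpty g
    with refl ← ∷→∷⁺ (trans (toList-++⁺ Γ₁ Δ₁) eq) = split f g

data Split-⁺++⁺ (Γ Δ : List⁺ Type) : List⁺ Type → Set where
  split : ∀ {Γ′ Δ′} → toList Γ ⊴[ i ] toList Γ′ → toList Δ ⊴[ j ] toList Δ′ →
          Split-⁺++⁺ Γ Δ (Γ′ ⁺++⁺ Δ′)

⊴-split-⁺++⁺ : ∀ Γ {Δ Θ} → toList (Γ ⁺++⁺ Δ) ⊴[ k ] toList Θ → Split-⁺++⁺ Γ Δ Θ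
⊴-split-⁺++⁺ Γ {Δ} {Θ} e = from (⊴-split (toList Γ) e) refl
  where
  from : ∀ {k Θ′} → Split (toList Γ) (toList Δ) k Θ′ → Θ′ ≡ toList Θ → Split-⁺++⁺ Γ Δ Θ
  from (split f g) eq with _ , refl ← ⊴-nonEmpty f | _ , refl ← ⊴-nonEmpty g
    with refl ← ∷→∷⁺ eq = split f g

-- No common rule other than the axiom can have a principal `A ⁺` on the left, so expansion touches
-- only the contexts; active formulas of the premises stay unexpanded.
simulate : ∀ {Γ Γ′} → CommonRule ps (Γ ⟶ C) → toList Γ ⊴[ k ] toList Γ′ →
           Lω (Γ′ ⟶ C) ⊎ (∃[ ps′ ] CommonRule ps′ (Γ′ ⟶ C) × Pointwise _⊑_ ps ps′)
simulate {Γ′ = _ ∷ _} ax (A ∷ []) = inj₂ (_ , ax , [])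
simulate {Γ′ = _ ∷ _} ax (expand {A = A} n []) =
  inj₁ (cast (∷→∷⁺ (trans (concat-singletons A n) (sym (++-identityʳ (A ∷ replicate n A)))))
    (→⁺ₙ (singletons A n) (axioms A n)))
simulate →∖ e = inj₂ (_ , →∖ , ⟨ _ ∷ e ⟩ ∷ [])
simulate (∖→ {Γ} {Π} {B = B}) e
  with split {Γ′ = Γ′} f g ← ⊴-split-++⁺ Γ e
  with split h (_ ∷ i) ← ⊴-split-⁺++⁺ Π g =
  inj₂ (_ , ∖→ {Γ = Γ′} , ⟨ h ⟩ ∷ ⟨ ⊴-++⁺ f (B ∷ i) ⟩ ∷ [])
simulate (→/ {A = A}) e =
  inj₂ (_ , →/ , ⟨ ⊴-++ e (A ∷ []) ⟩ ∷ [])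
simulate (/→ {Γ} {Π} {B = B}) e
  with split {Γ′ = Γ′} f (_ ∷ g) ← ⊴-split-++⁺ Γ e
  with split h i ← ⊴-split (toList Π) g
  with Π′ , refl ← ⊴-nonEmpty h =
  inj₂ (_ , /→ {Γ = Γ′} {Π′} , ⟨ h ⟩ ∷ ⟨ ⊴-++⁺ f (B ∷ i) ⟩ ∷ [])
simulate (→· {Γ}) e
  with split f g ← ⊴-split-⁺++⁺ Γ e =
  inj₂ (_ , →· , ⟨ f ⟩ ∷ ⟨ g ⟩ ∷ [])
simulate (·→ {Γ} {A = A} {B}) e
  with split {Γ′ = Γ′} f (_ ∷ g) ← ⊴-split-++⁺ Γ e =
  inj₂ (_ , ·→ {Γ = Γ′} , ⟨ ⊴-++⁺ f (A ∷ B ∷ g) ⟩ ∷ [])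
simulate (∨→ {Γ} {A₁ = A} {B}) e
  with split {Γ′ = Γ′} f (_ ∷ g) ← ⊴-split-++⁺ Γ e =
  inj₂ (_ , ∨→ {Γ = Γ′} , ⟨ ⊴-++⁺ f (A ∷ g) ⟩ ∷ ⟨ ⊴-++⁺ f (B ∷ g) ⟩ ∷ [])
simulate →∨₁ e = inj₂ (_ , →∨₁ , ⟨ e ⟩ ∷ [])
simulate →∨₂ e = inj₂ (_ , →∨₂ , ⟨ e ⟩ ∷ [])

-- From coalgebras to `Lω`

module _ {P : Sequent → Set} (step : Coalgebra P) where

  private
    Hypothesis : Sequent → Set
    Hypothesis t = ∀ {s s′} → s′ ≺ₛ t → P s → s ⊑ s′ → Lω s′

    derive-all : ∀ {t} → Hypothesis t → All P ps → Pointwise _⊑_ ps ps′ →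
                 All (_≺ₛ t) ps′ → All Lω ps′
    derive-all ih []       []       []       = []
    derive-all ih (x ∷ xs) (e ∷ es) (l ∷ ls) = ih l x e ∷ derive-all ih xs es ls

    -- Inner induction on `k` for a fixed goal: passing through `⁺→L` at an expanded formula leaves
    -- the goal unchanged but turns one counted copy into an ordinary formula.
    derive-step : ∀ {Γ Γ′} → Hypothesis (Γ′ ⟶ C) → P (Γ ⟶ C) →
                  toList Γ ⊴[ k ] toList Γ′ → Acc _<_ k → Lω (Γ′ ⟶ C)
    derive-step ih x e (acc rs) with step x
    ... | _ , common r , xs with simulate r e
    ...   | inj₁ d             = d
    ...   | inj₂ (_ , r′ , es) = common r′ (derive-all ih xs es (common-≺ₛ r′))
    derive-step {Γ′ = Γ′} ih x e (acc rs) | _ , →⁺₁ , y ∷ [] =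
      cast (∷→∷⁺ (++-identityʳ (toList Γ′)))
        (→⁺ₙ (Γ′ ∷ []) (ih (replace _ (_ ∷ []) [] _ ↭-refl ↭-refl (n<1+n _ ∷ [])) y ⟨ e ⟩ ∷ []))
    derive-step ih x e (acc rs) | _ , →⁺L {Π₁} {A = A} , y ∷ z ∷ []
      with split {Γ′ = Π₁′} {Π₂′} f g ← ⊴-split-⁺++⁺ Π₁ e =
      cast (sym (⁺++⁺≡++⁺ Π₁′ Π₂′))
        (→⁺L-admissible
          (ih (replace (A ⁺) (A ∷ []) (toList Π₂′) (toList Π₁′)
                (prep _ (++-comm (toList Π₁′) (toList Π₂′)))
                ↭-refl (n<1+n _ ∷ []))
              y ⟨ f ⟩)
          -- The succedent `A ⁺` persists; the measure drops because the non-empty `Π₁′` disappears.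
          (ih (replace (List⁺.head Π₁′) [] (List⁺.tail Π₁′) (A ⁺ ∷ toList Π₂′)
                (↭-sym (shift (A ⁺) (toList Π₁′) (toList Π₂′))) ↭-refl [])
              z ⟨ g ⟩))
    derive-step ih x e (acc rs) | _ , ⁺→L {Γ} {A = A} , y ∷ z ∷ [] with ⊴-split-++⁺ Γ e
    ... | split {Γ′ = Γ′} f (_ ∷ g) =
      -- The witness `x` is reused with a larger count, which is harmless since the goal itself
      -- becomes smaller.
      ⁺→ω {Γ = Γ′} λ n → ih (powers-≺ₛ Γ′ n) x ⟨ ⊴-++⁺ f (expand n g) ⟩
    -- `expand n` writes `suc n` copies, so `zero` means that a single copy is left.
    ... | split {i} f (expand zero g) =
      derive-step ih y (⊴-++⁺ f (A ∷ g)) (rs (+-monoʳ-< i (n<1+n _)))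
    ... | split {i} f (expand (suc n) g) =
      derive-step ih z (⊴-++⁺ f (A ∷ expand n g)) (rs (+-monoʳ-< i (n<1+n _)))

    derive-acc : ∀ {s s′} → Acc _≺_ ∣ s′ ∣ → P s → s ⊑ s′ → Lω s′
    derive-acc (acc rs) x ⟨ e ⟩ = derive-step (λ l → derive-acc (rs l)) x e (<-wellFounded _)

  coalgebra⇒Lω : P s → Lω s
  coalgebra⇒Lω {Γ ⟶ _} x = derive-acc (≺-wellFounded _) x ⟨ ⊴-refl (toList Γ) ⟩

proposition1 : ∀ (s : Sequent) → Lω s ⇔ L∞ s
proposition1 s = mk⇔ (coalgebra⇒L∞ Lω-coalgebra) λ d →
  coalgebra⇒Lω (occurs-coalgebra d) ([] , L∞.root d)
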